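{- A snake graph $\mathcal{G}$ is palindromic of even length if and only if it has a rotational symmetry at its center tile.
   Context: A tile is a unit square in the plane with sides parallel to the coordinate axes, viewed as a graph with 4 vertices and 4 edges. A snake graph with $d\ge 1$ tiles is a planar graph which is the union of tiles $G_1,\dots,G_d$ such that for each $i$, $G_{i+1}$ is the translate of $G_i$ by $(0,1)$ or by $(1,0)$; thus $G_i$ and $G_{i+1}$ share exactly one edge $e_i$ (the north edge of $G_i$, or its east edge). Snake graphs are considered up to translation. A sign function on a snake graph is a map $f$ from its set of edges to $\{+,-\}$ such that in every tile the north and west edges have the same sign, the south and east edges have the same sign, and the north and south edges have opposite signs. For a sequence $(a_1,\dots,a_n)$ of positive integers with $d=a_1+\cdots+a_n-1\ge 1$, the snake graph $\mathcal{G}[a_1,\dots,a_n]$ is the unique snake graph with tiles $G_1,\dots,G_d$ for which there exist a sign function $f$ and an edge $e_d\in\{\text{north edge of }G_d,\ \text{east edge of }G_d\}$ such that, with $e_0$ the south edge of $G_1$ and $e_i$ ($1\le i\le d-1$) the edge shared by $G_i$ and $G_{i+1}$, the sequence $(f(e_0),f(e_1),\dots,f(e_d))$ consists of $a_1$ copies of a sign $s$, followed by $a_2$ copies of $-s$, then $a_3$ copies of $s$, and so on alternately. A snake graph $\mathcal{G}$ is called palindromic of even length if $\mathcal{G}=\mathcal{G}[a_1,\dots,a_n]$ for some sequence of positive integers with $n$ even and $(a_1,\dots,a_n)=(a_n,\dots,a_1)$. A snake graph has a rotational symmetry at its center tile if it has a tile $G_i$ such that the rotation by $180^\circ$ about the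 center of $G_i$ maps the graph onto itself. -}

module Defs where

open import Data.Fin using (Fin; zero; suc)
open import Data.Integer using (ℤ; 0ℤ; 1ℤ; _+_; _-_)
open import Data.Irrelevant using ([_])
open import Data.List using (List; []; _∷_; _++_; length; map; replicate; reverse; tabulate)
open import Data.List.Relation.Unary.All using (All)
open import Data.Nat using (ℕ; suc; _<_)
open import Data.Nat.Divisibility using (_∣_)
open import Data.Product using (_×_; _,_; ∃-syntax)
open import Data.Refinement using (Refinement)
import Data.Refinement as Refinement
open import Data.Sign using (Sign; opposite)
open import Data.Vec using (Vec; []; _∷_; _∷ʳ_; lookup)
open import Level using (0ℓ)
open import Relation.Binary.PropositionalEquality using (_≡_; refl)
open import Relation.Unary using (Pred; _≐_)

Point : Set
Point = ℤ × ℤ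

-- The unit segment from p to p + (1,0), respectively from p to p + (0,1).
data Segment : Set where
  horizontal vertical : Point → Segment

data Step : Set where
  up right : Step

translate : Step → Point → Point
translate up    (x , y) = x , y + 1ℤ
translate right (x , y) = x + 1ℤ , y

-- A tile is given by its south-west corner.
Tile : Set
Tile = Point

data Corner : Set where
  sw se nw ne : Corner

data Side : Set where
  south east north west : Side

corner : Tile → Corner → Point
corner t sw = t
corner t se = translate right t
corner t nw = translate up t
corner t ne = translate up (translate right t)

side : Tile → Side → Segment
side t south = horizontal (corner t sw)
side t north = horizontal (corner t nw)
side t west  = vertical (corner t sw)
side t east  = vertical (corner t se)

-- A snake graph up to translation: the representative whose first tile has its
-- south-west corner at the origin.  There is one tile more than there are steps.
record SnakeGraph : Set where
  constructor snake
  field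
    {stepCount} : ℕ
    steps       : Vec Step stepCount

  tileCount : ℕ
  tileCount = suc stepCount

open SnakeGraph public

tileFrom : ∀ {n} → Tile → Vec Step n → Fin (suc n) → Tile
tileFrom t _        zero    = t
tileFrom t (s ∷ ss) (suc i) = tileFrom (translate s t) ss i

tile : (G : SnakeGraph) → Fin (tileCount G) → Tile
tile G = tileFrom (0ℤ , 0ℤ) (steps G)

IsVertex : SnakeGraph → Pred Point 0ℓ
IsVertex G p = ∃[ i ] ∃[ c ] p ≡ corner (tile G i) c

IsEdge : SnakeGraph → Pred Segment 0ℓ
IsEdge G e = ∃[ i ] ∃[ σ ] e ≡ side (tile G i) σ

-- The membership proof is irrelevant, so an edge lying on two tiles is counted once.
Edge : SnakeGraph → Set
Edge G = Refinement Segment (IsEdge G)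

edge : (G : SnakeGraph) → Fin (tileCount G) → Side → Edge G
edge G i σ = side (tile G i) σ Refinement., [ i , σ , refl ]

IsSignFunction : (G : SnakeGraph) → (Edge G → Sign) → Set
IsSignFunction G f = ∀ i →
  f (edge G i north) ≡ f (edge G i west) ×
  f (edge G i south) ≡ f (edge G i east) ×
  f (edge G i north) ≡ opposite (f (edge G i south))

-- The side along which a tile meets its translate by the given step.
exit : Step → Side
exit up    = north
exit right = east

-- The edges e₀, e₁, …, e_d.  The argument s selects e_d: the north edge of the
-- last tile for up, its east edge for right.
edgeSequence : (G : SnakeGraph) → Step → List (Edge G)
edgeSequence G s =
  edge G zero south ∷ tabulate (λ i → edge G i (exit (lookup (steps G ∷ʳ s) i)))

-- a₁ copies of s, then a₂ copies of the opposite sign, and so on alternately.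
alternatingBlocks : Sign → List ℕ → List Sign
alternatingBlocks s []       = []
alternatingBlocks s (a ∷ as) = replicate a s ++ alternatingBlocks (opposite s) as

-- G = 𝒢[a₁,…,aₙ].  The positivity of the aᵢ is included; comparing the lengths of
-- the two sign sequences gives tileCount G + 1 = a₁ + ⋯ + aₙ.
_IsSnakeGraphOf_ : SnakeGraph → List ℕ → Set
G IsSnakeGraphOf as =
  All (0 <_) as ×
  ∃[ f ] IsSignFunction G f ×
    ∃[ t ] ∃[ s ] map f (edgeSequence G t) ≡ alternatingBlocks s as

IsPalindromicOfEvenLength : SnakeGraph → Set
IsPalindromicOfEvenLength G =
  ∃[ as ] G IsSnakeGraphOf as × 2 ∣ length as × as ≡ reverse as

-- The rotation by 180° about the center (x + 1/2 , y + 1/2) of the tile (x , y).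
rotatePoint : Tile → Point → Point
rotatePoint (x , y) (u , v) = (x + x + 1ℤ) - u , (y + y + 1ℤ) - v

-- The rotation reverses segments: the base point of the image is the image of the
-- right, respectively upper, endpoint.
rotateSegment : Tile → Segment → Segment
rotateSegment t (horizontal p) = horizontal (rotatePoint t (translate right p))
rotateSegment t (vertical p)   = vertical (rotatePoint t (translate up p))

_MapsOntoItself_ : {A : Set} → (A → A) → Pred A 0ℓ → Set
f MapsOntoItself P = (λ y → ∃[ x ] P x × f x ≡ y) ≐ P

HasRotationalSymmetryAtCenterTile : SnakeGraph → Set
HasRotationalSymmetryAtCenterTile G = ∃[ i ]
  (rotatePoint (tile G i) MapsOntoItself IsVertex G) ×
  (rotateSegment (tile G i) MapsOntoItself IsEdge G)

{-# OPTIONS --safe #-}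
-- Both sides hold exactly when the word of steps is a palindrome of even length.
--
-- On the one side, a sign function is determined up to a global sign: it is the
-- parity of x + y on horizontal edges and the opposite parity on vertical ones.  So
-- f(eᵢ) is, up to a global sign, (-1)ⁱ times a sign recording the i-th letter of the
-- word (up, steps, t), where t selects the edge e_d.  Palindromic blocks of even
-- number make the sign sequence antisymmetric, u followed by the reversed opposite of
-- u, and this happens exactly when the word (up, steps, t) is an even palindrome.
--
-- On the other side, a unit square with south and north edges in the graph is a
-- tile, because a monotone path of tiles cannot contain the squares below and above
-- it without containing the square itself.  So a rotation preserving the edges
-- permutes the tiles.  The tile of index j lies on the line x + y = j; hence the
-- rotation reverses the order of the tiles, and with it the word of steps.
module Submission where

open import Defs
open import Data.Fin using (Fin; zero; suc; inject₁)
open import Data.Integer using (ℤ; -[1+_]; 0ℤ; 1ℤ) renaming (+_ to pos)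
import Data.Integer as ℤ
import Data.Integer.Properties as ℤ
open import Data.Integer.Tactic.RingSolver using (solve-∀)
open import Data.Irrelevant using (Irrelevant; [_])
open import Data.List using (List; []; _∷_; _++_; _∷ʳ_; drop; length; map; replicate; reverse; tabulate; take)
open import Data.List.Properties hiding (sum-++)
open import Data.List.Relation.Binary.Permutation.Propositional using (↭-sym)
open import Data.List.Relation.Binary.Permutation.Propositional.Properties using (↭-reverse)
import Data.List.Relation.Binary.Permutation.Propositional.Properties as ↭
open import Data.List.Relation.Binary.Pointwise using (Pointwise-≡⇒≡)
import Data.List.Relation.Binary.Pointwise as Pointwise
open import Data.List.Relation.Binary.Prefix.Heterogeneous using (Prefix; []; _∷_)
import Data.List.Relation.Binary.Prefix.Heterogeneous.Properties as Prefix
open import Data.List.Relation.Unary.All using (All; []; _∷_)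
import Data.List.Relation.Unary.All.Properties as All
open import Data.Nat using (ℕ; zero; suc; _+_; _*_; _∸_; _⊓_; _<_; _≤_; z<s)
open import Data.Nat.Divisibility using (_∣_; divides)
open import Data.Nat.ListAction using (sum)
open import Data.Nat.ListAction.Properties using (sum-++; sum-↭)
import Data.Nat.Properties as ℕ
open import Data.Nat.Tactic.RingSolver renaming (solve-∀ to solveℕ-∀)
open import Data.Product using (_×_; _,_; proj₁; proj₂; ∃-syntax)
open import Data.Sum using (_⊎_; inj₁; inj₂)
import Data.Refinement as Refinement
open import Data.Sign using (Sign; opposite) renaming (+ to plus; - to minus; _*_ to _·_)
import Data.Sign.Properties as Sign
open import Data.Vec using (Vec; []; _∷_; lookup; toList)
import Data.Vec as Vec
open import Function using (_∘_; flip)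
open import Function.Bundles using (_⇔_; mk⇔)
open import Relation.Binary.PropositionalEquality
open import Algebra.Properties.AbelianGroup ℤ.+-0-abelianGroup using (∙-cancelʳ)

private
  variable
    A : Set

-- Even palindromes

IsEvenPalindrome : List A → Set
IsEvenPalindrome xs = ∃[ ys ] xs ≡ ys ++ reverse ys

++-injective : (xs xs′ : List A) {ys ys′ : List A} → length xs ≡ length xs′ →
               xs ++ ys ≡ xs′ ++ ys′ → xs ≡ xs′ × ys ≡ ys′
++-injective []       []         _  eq = refl , eq
++-injective (x ∷ xs) (x′ ∷ xs′) l  eq
  with refl , eq′ ← ∷-injective eq
  with refl , r ← ++-injective xs xs′ (ℕ.suc-injective l) eq′ = refl , r

halves : ∀ n (xs : List A) → length xs ≡ n + n →
         ∃[ ys ] ∃[ zs ] length ys ≡ n × length zs ≡ n × xs ≡ ys ++ zs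
halves n xs l = take n xs , drop n xs
  , trans (length-take n xs) (trans (cong (n ⊓_) l) (ℕ.m≤n⇒m⊓n≡m (ℕ.m≤m+n n n)))
  , trans (length-drop n xs) (trans (cong (_∸ n) l) (ℕ.m+n∸n≡m n n))
  , sym (take++drop≡id n xs)

-- Reversing `ys ++ zs` gives `reverse zs ++ reverse ys`; when both halves have the same length,
-- comparing the two words half by half yields `zs ≡ reverse ys`.
isEvenPalindrome : (xs : List A) → 2 ∣ length xs → xs ≡ reverse xs → IsEvenPalindrome xs
isEvenPalindrome xs (divides n l) pal
  with ys , zs , lys , lzs , refl ←
       halves n xs (trans l (trans (ℕ.*-comm n 2) (cong (n +_) (ℕ.+-identityʳ n))))
  with _ , zs≡ ← ++-injective ys (reverse zs) (trans lys (sym (trans (length-reverse zs) lzs)))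
                   (trans pal (reverse-++ ys zs))
  = ys , cong (ys ++_) zs≡

reverse-palindrome : (ys : List A) → reverse (ys ++ reverse ys) ≡ ys ++ reverse ys
reverse-palindrome ys =
  trans (reverse-++ ys (reverse ys)) (cong (_++ reverse ys) (reverse-involutive ys))

palindrome-even : (ys : List A) → 2 ∣ length (ys ++ reverse ys)
palindrome-even ys = divides (length ys) (begin
  length (ys ++ reverse ys)        ≡⟨ length-++ ys ⟩
  length ys + length (reverse ys)  ≡⟨ cong (length ys +_) (length-reverse ys) ⟩
  length ys + length ys            ≡⟨ cong (length ys +_) (sym (ℕ.+-identityʳ _)) ⟩
  2 * length ys                    ≡⟨ ℕ.*-comm 2 (length ys) ⟩
  length ys * 2                    ∎)
  where open ≡-Reasoning

reverse-replicate : ∀ n (x : A) → reverse (replicate n x) ≡ replicate n x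
reverse-replicate zero    x = refl
reverse-replicate (suc n) x = begin
  reverse (x ∷ replicate n x)   ≡⟨ unfold-reverse x (replicate n x) ⟩
  reverse (replicate n x) ∷ʳ x  ≡⟨ cong (_∷ʳ x) (reverse-replicate n x) ⟩
  replicate n x ∷ʳ x            ≡⟨ replicate-∷ʳ n ⟩
  x ∷ replicate n x             ∎
  where
  open ≡-Reasoning
  replicate-∷ʳ : ∀ n → replicate n x ∷ʳ x ≡ x ∷ replicate n x
  replicate-∷ʳ zero    = refl
  replicate-∷ʳ (suc n) = cong (x ∷_) (replicate-∷ʳ n)

-- Alternating sign words

reverseOpposite : List Sign → List Sign
reverseOpposite w = reverse (map opposite w)

reverseOpposite-++ : ∀ u v → reverseOpposite (u ++ v) ≡ reverseOpposite v ++ reverseOpposite u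
reverseOpposite-++ u v = trans (cong reverse (map-++ opposite u v)) (reverse-++ (map opposite u) _)

-- Common form of `alternatingBlocks` and of the sign word of a word of steps, so that one
-- palindrome lemma serves both.
alternate : (Sign → A → List Sign) → Sign → List A → List Sign
alternate g s []       = []
alternate g s (x ∷ xs) = g s x ++ alternate g (opposite s) xs

module _ (g : Sign → A → List Sign)
         (g-opposite : ∀ s x → reverseOpposite (g s x) ≡ g (opposite s) x) where

  open ≡-Reasoning

  -- The tail zs makes the induction go through: the closing letter of the palindrome
  -- is absorbed into it.
  alternate-palindrome-++ : ∀ s xs zs →
    alternate g s (xs ++ reverse xs ++ zs) ≡
    alternate g s xs ++ reverseOpposite (alternate g s xs) ++ alternate g s zs
  alternate-palindrome-++ s []       zs = refl
  alternate-palindrome-++ s (x ∷ xs) zs = begin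
    w ++ alternate g s′ (xs ++ reverse (x ∷ xs) ++ zs)
      ≡⟨ cong (λ v → w ++ alternate g s′ (xs ++ v)) reverse-∷-++ ⟩
    w ++ alternate g s′ (xs ++ reverse xs ++ x ∷ zs)
      ≡⟨ cong (w ++_) (alternate-palindrome-++ s′ xs (x ∷ zs)) ⟩
    w ++ u ++ reverseOpposite u ++ g s′ x ++ alternate g (opposite s′) zs
      ≡⟨ cong (λ r → w ++ u ++ reverseOpposite u ++ g s′ x ++ alternate g r zs)
           (Sign.opposite-involutive s) ⟩
    w ++ u ++ reverseOpposite u ++ g s′ x ++ alternate g s zs
      ≡⟨ cong (λ v → w ++ u ++ reverseOpposite u ++ v ++ alternate g s zs) (g-opposite s x) ⟨
    w ++ u ++ reverseOpposite u ++ reverseOpposite w ++ alternate g s zs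
      ≡⟨ cong (λ v → w ++ u ++ v) (++-assoc (reverseOpposite u) (reverseOpposite w) _) ⟨
    w ++ u ++ (reverseOpposite u ++ reverseOpposite w) ++ alternate g s zs
      ≡⟨ cong (λ v → w ++ u ++ v ++ alternate g s zs) (reverseOpposite-++ w u) ⟨
    w ++ u ++ reverseOpposite (w ++ u) ++ alternate g s zs
      ≡⟨ ++-assoc w u _ ⟨
    (w ++ u) ++ reverseOpposite (w ++ u) ++ alternate g s zs ∎
    where
    s′ = opposite s
    w = g s x
    u = alternate g s′ xs
    reverse-∷-++ : reverse (x ∷ xs) ++ zs ≡ reverse xs ++ x ∷ zs
    reverse-∷-++ = trans (cong (_++ zs) (unfold-reverse x xs)) (++-assoc (reverse xs) _ zs)

  -- The two mirror occurrences of a letter in `xs ++ reverse xs` stand at positions of opposite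
  -- parity, so they are read with opposite signs; `g-opposite` turns this into antisymmetry of the
  -- resulting word.
  alternate-palindrome : ∀ s xs →
    alternate g s (xs ++ reverse xs) ≡ alternate g s xs ++ reverseOpposite (alternate g s xs)
  alternate-palindrome s xs = begin
    alternate g s (xs ++ reverse xs)
      ≡⟨ cong (λ v → alternate g s (xs ++ v)) (++-identityʳ (reverse xs)) ⟨
    alternate g s (xs ++ reverse xs ++ [])
      ≡⟨ alternate-palindrome-++ s xs [] ⟩
    u ++ reverseOpposite u ++ []
      ≡⟨ cong (u ++_) (++-identityʳ (reverseOpposite u)) ⟩
    u ++ reverseOpposite u ∎
    where u = alternate g s xs

alternatingBlocks≡alternate : ∀ s as → alternatingBlocks s as ≡ alternate (flip replicate) s as
alternatingBlocks≡alternate s []       = refl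
alternatingBlocks≡alternate s (a ∷ as) =
  cong (replicate a s ++_) (alternatingBlocks≡alternate (opposite s) as)

alternatingBlocks-palindrome : ∀ s as →
  alternatingBlocks s (as ++ reverse as) ≡
  alternatingBlocks s as ++ reverseOpposite (alternatingBlocks s as)
alternatingBlocks-palindrome s as
  rewrite alternatingBlocks≡alternate s (as ++ reverse as) | alternatingBlocks≡alternate s as
  = alternate-palindrome (flip replicate)
      (λ s a → trans (cong reverse (map-replicate opposite a s)) (reverse-replicate a (opposite s)))
      s as

sameOrOpposite : ∀ s t → t ≡ s ⊎ t ≡ opposite s
sameOrOpposite plus  plus  = inj₁ refl
sameOrOpposite plus  minus = inj₂ refl
sameOrOpposite minus plus  = inj₂ refl
sameOrOpposite minus minus = inj₁ refl

-- Run-length encoding. The first run has the form `suc a` so that a preceding equal sign lengthens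
-- it, while a preceding opposite sign opens a new run of length one.
runs : ∀ s w → ∃[ a ] ∃[ as ] All (0 <_) as × s ∷ w ≡ alternatingBlocks s (suc a ∷ as)
runs s []      = 0 , [] , [] , refl
runs s (t ∷ w) with sameOrOpposite s t
... | inj₁ refl = let a , as , 0<as , eq = runs s w in suc a , as , 0<as , cong (s ∷_) eq
... | inj₂ refl = let a , as , 0<as , eq = runs (opposite s) w in
  0 , suc a ∷ as , z<s ∷ 0<as , cong (s ∷_) eq

-- The signs of the edges e₀, …, e_d

stepSign : Step → Sign
stepSign up    = plus
stepSign right = minus

-- The alternating factor stands for the opposite of the south sign of the current tile: leaving
-- through the north edge (`up`) gives this factor, leaving through the east edge (`right`), signed
-- like the south edge, gives its opposite.
signWord : Sign → List Step → List Sign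
signWord = alternate (λ s h → s · stepSign h ∷ [])

signWord-palindrome : ∀ s hs →
  signWord s (hs ++ reverse hs) ≡ signWord s hs ++ reverseOpposite (signWord s hs)
signWord-palindrome = alternate-palindrome _ λ where
  plus  h → refl
  minus h → cong (_∷ []) (Sign.opposite-involutive (stepSign h))

stepSign-injective : ∀ {h k} → stepSign h ≡ stepSign k → h ≡ k
stepSign-injective {up}    {up}    _ = refl
stepSign-injective {right} {right} _ = refl

signWord-injective : ∀ s hs ks → signWord s hs ≡ signWord s ks → hs ≡ ks
signWord-injective s []       []       _  = refl
signWord-injective s (h ∷ hs) (k ∷ ks) eq =
  cong₂ _∷_ (stepSign-injective (Sign.*-cancelˡ-≡ s _ _ (∷-injectiveˡ eq)))
            (signWord-injective (opposite s) hs ks (∷-injectiveʳ eq))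

stepSign-surjective : ∀ s t → ∃[ h ] s · stepSign h ≡ t
stepSign-surjective plus  plus  = up , refl
stepSign-surjective plus  minus = right , refl
stepSign-surjective minus plus  = right , refl
stepSign-surjective minus minus = up , refl

-- With injectivity, this makes words of steps and words of signs correspond bijectively for a fixed
-- initial factor, so half of an antisymmetric sign word can be pulled back to steps.
signWord-surjective : ∀ s w → ∃[ hs ] signWord s hs ≡ w
signWord-surjective s []      = [] , refl
signWord-surjective s (t ∷ w) =
  let h , eq = stepSign-surjective s t
      hs , eqs = signWord-surjective (opposite s) w
  in h ∷ hs , cong₂ _∷_ eq eqs

entry : Step → Side
entry up    = south
entry right = west

IsTileSigning : (Side → Sign) → Set
IsTileSigning F = F north ≡ F west × F south ≡ F east × F north ≡ opposite (F south)

·-minus : ∀ s → s · minus ≡ opposite s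
·-minus plus  = refl
·-minus minus = refl

exit-sign : ∀ F → IsTileSigning F → ∀ h → F (exit h) ≡ opposite (F south) · stepSign h
exit-sign F (n≡w , s≡e , n≡-s) up    = trans n≡-s (sym (Sign.*-identityʳ _))
exit-sign F (n≡w , s≡e , n≡-s) right = begin
  F east                         ≡⟨ s≡e ⟨
  F south                        ≡⟨ Sign.opposite-involutive (F south) ⟨
  opposite (opposite (F south))  ≡⟨ ·-minus (opposite (F south)) ⟨
  opposite (F south) · minus     ∎
  where open ≡-Reasoning

entry-sign : ∀ F → IsTileSigning F → ∀ h → F south ≡ F (entry h) · stepSign h
entry-sign F (n≡w , s≡e , n≡-s) up    = sym (Sign.*-identityʳ _)
entry-sign F (n≡w , s≡e , n≡-s) right = begin
  F south                        ≡⟨ Sign.opposite-involutive (F south) ⟨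
  opposite (opposite (F south))  ≡⟨ cong opposite (trans (sym n≡-s) n≡w) ⟩
  opposite (F west)              ≡⟨ ·-minus (F west) ⟨
  F west · minus                 ∎
  where open ≡-Reasoning

exit-signs : ∀ {n} (ss : Vec Step n) (F : Fin (suc n) → Side → Sign) →
  (∀ i → IsTileSigning (F i)) →
  (∀ i → F (inject₁ i) (exit (lookup ss i)) ≡ F (suc i) (entry (lookup ss i))) →
  ∀ t → tabulate (λ i → F i (exit (lookup (ss Vec.∷ʳ t) i))) ≡
        signWord (opposite (F zero south)) (toList ss ∷ʳ t)
exit-signs []       F signing glue t = cong (_∷ []) (exit-sign (F zero) (signing zero) t)
exit-signs (h ∷ ss) F signing glue t = cong₂ _∷_ (exit-sign (F zero) (signing zero) h) (begin
  tabulate (λ i → F (suc i) (exit (lookup (ss Vec.∷ʳ t) i)))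
    ≡⟨ exit-signs ss (F ∘ suc) (signing ∘ suc) (glue ∘ suc) t ⟩
  signWord (opposite (F (suc zero) south)) (toList ss ∷ʳ t)
    ≡⟨ cong (λ s → signWord (opposite s) (toList ss ∷ʳ t)) south≡-south ⟩
  signWord (opposite (opposite (F zero south))) (toList ss ∷ʳ t) ∎)
  where
  open ≡-Reasoning
  south≡-south : F (suc zero) south ≡ opposite (F zero south)
  south≡-south = begin
    F (suc zero) south
      ≡⟨ entry-sign (F (suc zero)) (signing (suc zero)) h ⟩
    F (suc zero) (entry h) · stepSign h
      ≡⟨ cong (_· stepSign h) (glue zero) ⟨
    F zero (exit h) · stepSign h
      ≡⟨ cong (_· stepSign h) (exit-sign (F zero) (signing zero) h) ⟩
    opposite (F zero south) · stepSign h · stepSign h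
      ≡⟨ Sign.*-assoc (opposite (F zero south)) (stepSign h) (stepSign h) ⟩
    opposite (F zero south) · (stepSign h · stepSign h)
      ≡⟨ cong (opposite (F zero south) ·_) (Sign.s*s≡+ (stepSign h)) ⟩
    opposite (F zero south) · plus
      ≡⟨ Sign.*-identityʳ _ ⟩
    opposite (F zero south) ∎

tileFrom-suc : ∀ {n} t (ss : Vec Step n) i →
  tileFrom t ss (suc i) ≡ translate (lookup ss i) (tileFrom t ss (inject₁ i))
tileFrom-suc t (s ∷ ss) zero    = tileFrom-zero ss
  where
  tileFrom-zero : ∀ {n t} (ss : Vec Step n) → tileFrom t ss zero ≡ t
  tileFrom-zero []       = refl
  tileFrom-zero (_ ∷ ss) = refl
tileFrom-suc t (s ∷ ss) (suc i) = tileFrom-suc (translate s t) ss i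

exit≡entry : ∀ t s → side t (exit s) ≡ side (translate s t) (entry s)
exit≡entry t up    = refl
exit≡entry t right = refl

-- Membership proofs are irrelevant, so equal segments give equal edges. The helper abstracts over
-- the segments to let the equation be matched with `refl`.
edge-cong : ∀ G i j {σ τ} → side (tile G i) σ ≡ side (tile G j) τ → edge G i σ ≡ edge G j τ
edge-cong G i j {σ} {τ} eq = lemma eq [ i , σ , refl ] [ j , τ , refl ]
  where
  lemma : ∀ {e e′} → e ≡ e′ → (p : Irrelevant (IsEdge G e)) (q : Irrelevant (IsEdge G e′)) →
          (e Refinement., p) ≡ (e′ Refinement., q)
  lemma refl _ _ = refl

-- The leading `up` accounts for e₀, seen as the north edge of a virtual tile below the first one.
edgeSequence-signs : ∀ G {f} → IsSignFunction G f → ∀ t →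
  map f (edgeSequence G t) ≡
  signWord (f (edge G zero south)) (up ∷ toList (steps G) ∷ʳ t)
edgeSequence-signs G {f} signing t = cong₂ _∷_ (sym (Sign.*-identityʳ _)) (begin
  map f (tabulate (λ i → edge G i (exit (lookup (steps G Vec.∷ʳ t) i))))
    ≡⟨ map-tabulate (λ i → edge G i (exit (lookup (steps G Vec.∷ʳ t) i))) f ⟩
  tabulate (λ i → f (edge G i (exit (lookup (steps G Vec.∷ʳ t) i))))
    ≡⟨ exit-signs (steps G) (λ i σ → f (edge G i σ)) signing
         (λ i → cong f (edge-cong G (inject₁ i) (suc i) (shared i))) t ⟩
  signWord (opposite (f (edge G zero south))) (toList (steps G) ∷ʳ t) ∎)
  where
  open ≡-Reasoning
  shared : ∀ i → side (tile G (inject₁ i)) (exit (lookup (steps G) i)) ≡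
                 side (tile G (suc i)) (entry (lookup (steps G) i))
  shared i = trans (exit≡entry _ (lookup (steps G) i))
    (cong (λ u → side u (entry (lookup (steps G) i))) (sym (tileFrom-suc _ (steps G) i)))

-- The parity sign function

-1^ℕ_ : ℕ → Sign
-1^ℕ zero  = plus
-1^ℕ suc n = opposite (-1^ℕ n)

-1^_ : ℤ → Sign
-1^ (pos n)  = -1^ℕ n
-1^ -[1+ n ] = opposite (-1^ℕ n)

-1^-+1 : ∀ z → -1^ (z ℤ.+ 1ℤ) ≡ opposite (-1^ z)
-1^-+1 (pos n)      = cong -1^ℕ_ (ℕ.+-comm n 1)
-1^-+1 -[1+ zero ]  = refl
-1^-+1 -[1+ suc n ] = sym (Sign.opposite-involutive _)

segmentSign : Segment → Sign
segmentSign (horizontal (x , y)) = -1^ x · -1^ y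
segmentSign (vertical (x , y))   = opposite (-1^ x · -1^ y)

segmentSign-isSignFunction : ∀ G → IsSignFunction G (segmentSign ∘ Refinement.value)
segmentSign-isSignFunction G i with tile G i
... | x , y rewrite -1^-+1 x | -1^-+1 y with -1^ x | -1^ y
... | plus  | plus  = refl , refl , refl
... | plus  | minus = refl , refl , refl
... | minus | plus  = refl , refl , refl
... | minus | minus = refl , refl , refl

-- Palindromic block sequences and even palindromes of steps

palindromic⇒evenPalindrome : ∀ G → IsPalindromicOfEvenLength G → IsEvenPalindrome (toList (steps G))
palindromic⇒evenPalindrome G (as , (_ , f , signing , t , s , eq) , even , pal)
  with bs , refl ← isEvenPalindrome as even pal
  -- The first half of the signs is read back as steps with the factor f(e₀), so that both sides
  -- become sign words with the same factor and injectivity applies.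
  with us , us≡ ← signWord-surjective (f (edge G zero south)) (alternatingBlocks s bs)
  = close us (signWord-injective σ _ _ (begin
      signWord σ (up ∷ toList (steps G) ∷ʳ t)        ≡⟨ edgeSequence-signs G signing t ⟨
      map f (edgeSequence G t)                       ≡⟨ eq ⟩
      alternatingBlocks s (bs ++ reverse bs)         ≡⟨ alternatingBlocks-palindrome s bs ⟩
      u ++ reverseOpposite u                         ≡⟨ cong (λ v → v ++ reverseOpposite v) us≡ ⟨
      signWord σ us ++ reverseOpposite (signWord σ us) ≡⟨ signWord-palindrome σ us ⟨
      signWord σ (us ++ reverse us)                  ∎))
  where
  open ≡-Reasoning
  σ = f (edge G zero south)
  u = alternatingBlocks s bs
  -- The word on the left starts with `up`, so `us` is nonempty; removing the first and last letters
  -- of both sides leaves the steps alone.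
  close : ∀ us → up ∷ toList (steps G) ∷ʳ t ≡ us ++ reverse us →
          IsEvenPalindrome (toList (steps G))
  close (h ∷ us) eq = us , ∷ʳ-injectiveˡ _ _ (trans (∷-injectiveʳ eq)
    (trans (cong (us ++_) (unfold-reverse h us)) (sym (++-assoc us (reverse us) (h ∷ [])))))

evenPalindrome⇒palindromic : ∀ G → IsEvenPalindrome (toList (steps G)) → IsPalindromicOfEvenLength G
evenPalindrome⇒palindromic G (cs , steps≡)
  -- The word encoded is `signWord plus (up ∷ cs)`: its first sign is `plus`, the value of `-1^ 0ℤ`,
  -- and `cs` is read with the opposite factor.
  with a , as , 0<as , u≡ ← runs (-1^ 0ℤ) (signWord minus cs)
  = bs ++ reverse bs
  , (All.++⁺ (z<s ∷ 0<as) (↭.All-resp-↭ (↭-sym (↭-reverse bs)) (z<s ∷ 0<as))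
    -- The last edge is chosen north, so that its letter `up` mirrors the leading `up` of e₀.
    , segmentSign ∘ Refinement.value , segmentSign-isSignFunction G , up , plus
    , trans (edgeSequence-signs G (segmentSign-isSignFunction G) up) signs)
  , palindrome-even bs , sym (reverse-palindrome bs)
  where
  open ≡-Reasoning
  bs = suc a ∷ as
  u = alternatingBlocks plus bs
  word≡ : up ∷ toList (steps G) ∷ʳ up ≡ (up ∷ cs) ++ reverse (up ∷ cs)
  word≡ = cong (up ∷_) (begin
    toList (steps G) ∷ʳ up   ≡⟨ cong (_∷ʳ up) steps≡ ⟩
    (cs ++ reverse cs) ∷ʳ up ≡⟨ ++-assoc cs (reverse cs) _ ⟩
    cs ++ reverse cs ∷ʳ up   ≡⟨ cong (cs ++_) (unfold-reverse up cs) ⟨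
    cs ++ reverse (up ∷ cs)  ∎)
  signs : signWord plus (up ∷ toList (steps G) ∷ʳ up) ≡ alternatingBlocks plus (bs ++ reverse bs)
  signs = begin
    signWord plus (up ∷ toList (steps G) ∷ʳ up)
      ≡⟨ cong (signWord plus) word≡ ⟩
    signWord plus ((up ∷ cs) ++ reverse (up ∷ cs))
      ≡⟨ signWord-palindrome plus (up ∷ cs) ⟩
    signWord plus (up ∷ cs) ++ reverseOpposite (signWord plus (up ∷ cs))
      ≡⟨ cong (λ v → v ++ reverseOpposite v) u≡ ⟩
    u ++ reverseOpposite u
      ≡⟨ alternatingBlocks-palindrome plus bs ⟨
    alternatingBlocks plus (bs ++ reverse bs) ∎

-- Tiles as positions of prefixes of the word of steps

infix 4 _≼_
_≼_ : List A → List A → Set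
_≼_ = Prefix _≡_

≼-refl : {xs : List A} → xs ≼ xs
≼-refl = Prefix.fromPointwise (Pointwise.refl refl)

≼-split : {xs ys : List A} → xs ≼ ys → ∃[ zs ] ys ≡ xs ++ zs
≼-split {ys = ys} []   = ys , refl
≼-split (refl ∷ xs≼ys) = let zs , eq = ≼-split xs≼ys in zs , cong (_ ∷_) eq

≼-++ : (xs ys : List A) → xs ≼ xs ++ ys
≼-++ []       ys = []
≼-++ (x ∷ xs) ys = refl ∷ ≼-++ xs ys

≼-length⇒≡ : {xs ys : List A} → length xs ≡ length ys → xs ≼ ys → xs ≡ ys
≼-length⇒≡ l xs≼ys = Pointwise-≡⇒≡ (Prefix.toPointwise l xs≼ys)

indicator : Step → Step → ℕ
indicator up    up    = 1
indicator up    right = 0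
indicator right up    = 0
indicator right right = 1

-- Written as a sum, so that invariance under reversal follows from invariance of sums under
-- permutation.
count : Step → List Step → ℕ
count s us = sum (map (indicator s) us)

count-++ : ∀ s us vs → count s (us ++ vs) ≡ count s us + count s vs
count-++ s us vs = trans (cong sum (map-++ (indicator s) us vs)) (sum-++ (map (indicator s) us) _)

count-reverse : ∀ s us → count s (reverse us) ≡ count s us
count-reverse s us = sum-↭ (↭.map⁺ (indicator s) (↭-reverse us))

length≡count : ∀ us → length us ≡ count up us + count right us
length≡count []           = refl
length≡count (up ∷ us)    = cong suc (length≡count us)
length≡count (right ∷ us) = trans (cong suc (length≡count us)) (sym (ℕ.+-suc (count up us) _))

offset : Tile → List Step → Tile
offset (x , y) us = x ℤ.+ pos (count right us) , y ℤ.+ pos (count up us)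

position : List Step → Tile
position = offset (0ℤ , 0ℤ)

offset-[] : ∀ t → offset t [] ≡ t
offset-[] (x , y) = cong₂ _,_ (ℤ.+-identityʳ x) (ℤ.+-identityʳ y)

offset-∷ : ∀ t s us → offset t (s ∷ us) ≡ offset (translate s t) us
offset-∷ (x , y) up    us = cong (_ ,_) (sym (ℤ.+-assoc y 1ℤ _))
offset-∷ (x , y) right us = cong (_, _) (sym (ℤ.+-assoc x 1ℤ _))

-- Indices are traded for prefixes of the word, on which splitting and reversal act directly.
tileFrom⇒offset : ∀ {n} t (ss : Vec Step n) i →
  ∃[ us ] us ≼ toList ss × tileFrom t ss i ≡ offset t us
tileFrom⇒offset t []       zero    = [] , [] , sym (offset-[] t)
tileFrom⇒offset t (s ∷ ss) zero    = [] , [] , sym (offset-[] t)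
tileFrom⇒offset t (s ∷ ss) (suc i) =
  let us , us≼ss , eq = tileFrom⇒offset (translate s t) ss i
  in s ∷ us , refl ∷ us≼ss , trans eq (sym (offset-∷ t s us))

offset⇒tileFrom : ∀ {n} t (ss : Vec Step n) {us} → us ≼ toList ss →
  ∃[ i ] tileFrom t ss i ≡ offset t us
offset⇒tileFrom t []       []                 = zero , sym (offset-[] t)
offset⇒tileFrom t (s ∷ ss) []                 = zero , sym (offset-[] t)
offset⇒tileFrom t (s ∷ ss) {_ ∷ us} (refl ∷ us≼ss) =
  let i , eq = offset⇒tileFrom (translate s t) ss us≼ss
  in suc i , trans eq (sym (offset-∷ t s us))

-- Central symmetry of a lattice path

-- The two counts are the coordinates of `position`, so this is the point reflection in
-- `position cs` acting on the lattice points of the path.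
IsSymmetricAbout : List Step → List Step → Set
IsSymmetricAbout ss cs = ∀ {us} → us ≼ ss →
  ∃[ vs ] vs ≼ ss × (∀ s → count s us + count s vs ≡ count s cs + count s cs)

-- If `us` is followed by `vs` in the palindrome, then `reverse vs` is again a prefix, and its
-- counts complement those of `us` to the counts of the whole word.
evenPalindrome⇒symmetric : ∀ cs → IsSymmetricAbout (cs ++ reverse cs) cs
evenPalindrome⇒symmetric cs {us} us≼ss with vs , eq ← ≼-split us≼ss
  = reverse vs , subst (reverse vs ≼_) reversed (≼-++ (reverse vs) (reverse us)) , counts
  where
  open ≡-Reasoning
  reversed : reverse vs ++ reverse us ≡ cs ++ reverse cs
  reversed = trans (sym (reverse-++ us vs)) (trans (cong reverse (sym eq)) (reverse-palindrome cs))
  counts : ∀ s → count s us + count s (reverse vs) ≡ count s cs + count s cs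
  counts s = begin
    count s us + count s (reverse vs)  ≡⟨ cong (count s us +_) (count-reverse s vs) ⟩
    count s us + count s vs            ≡⟨ count-++ s us vs ⟨
    count s (us ++ vs)                 ≡⟨ cong (count s) eq ⟨
    count s (cs ++ reverse cs)         ≡⟨ count-++ s cs (reverse cs) ⟩
    count s cs + count s (reverse cs)  ≡⟨ cong (count s cs +_) (count-reverse s cs) ⟩
    count s cs + count s cs            ∎

≼-uncons-counts : ∀ x us {ys} →
  ∃[ vs ] vs ≼ x ∷ ys × (∀ s → count s (x ∷ us) ≡ count s vs) →
  ∃[ vs ] vs ≼ ys × (∀ s → count s us ≡ count s vs)
≼-uncons-counts up    us ([] , _ , e) with () ← e up
≼-uncons-counts right us ([] , _ , e) with () ← e right
≼-uncons-counts x us (_ ∷ vs , refl ∷ vs≼ys , e) =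
  vs , vs≼ys , λ s → ℕ.+-cancelˡ-≡ (indicator s x) _ _ (e s)

-- A monotone lattice path is determined by the points it visits: the point after one letter forces
-- the first letter of `ys`, which is then cancelled from all the counts.
≼-from-counts : ∀ xs {ys} →
  (∀ {us} → us ≼ xs → ∃[ vs ] vs ≼ ys × (∀ s → count s us ≡ count s vs)) → xs ≼ ys
≼-from-counts []       h = []
≼-from-counts (x ∷ xs) h with h {x ∷ []} (refl ∷ [])
≼-from-counts (up    ∷ xs) h | [] , _ , e with () ← e up
≼-from-counts (right ∷ xs) h | [] , _ , e with () ← e right
≼-from-counts (up    ∷ xs) h | right ∷ _ , refl ∷ _ , e with () ← e right
≼-from-counts (right ∷ xs) h | up    ∷ _ , refl ∷ _ , e with () ← e up
≼-from-counts (up    ∷ xs) h | up    ∷ _ , refl ∷ _ , _ =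
  refl ∷ ≼-from-counts xs λ {us} us≼xs → ≼-uncons-counts up us (h (refl ∷ us≼xs))
≼-from-counts (right ∷ xs) h | right ∷ _ , refl ∷ _ , _ =
  refl ∷ ≼-from-counts xs λ {us} us≼xs → ≼-uncons-counts right us (h (refl ∷ us≼xs))

-- The reflection exchanges the ends of the path, so the reversed path visits the same points as the
-- path itself and must coincide with it.
symmetric⇒evenPalindrome : ∀ {ss} cs → IsSymmetricAbout ss cs → IsEvenPalindrome ss
symmetric⇒evenPalindrome {ss} cs symmetric =
  isEvenPalindrome ss (divides (length cs) (trans length-ss (double (length cs)))) (sym ss-palindrome)
  where
  open ≡-Reasoning
  double : ∀ n → n + n ≡ n * 2
  double = solveℕ-∀
  interchange : ∀ a b c d → (a + b) + (c + d) ≡ (a + c) + (b + d)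
  interchange = solveℕ-∀
  lengths : ∀ {us vs} → (∀ s → count s us + count s vs ≡ count s cs + count s cs) →
            length us + length vs ≡ length cs + length cs
  lengths {us} {vs} e rewrite length≡count us | length≡count vs | length≡count cs = begin
    (count up us + count right us) + (count up vs + count right vs)
      ≡⟨ interchange (count up us) _ _ _ ⟩
    (count up us + count up vs) + (count right us + count right vs)
      ≡⟨ cong₂ _+_ (e up) (e right) ⟩
    (count up cs + count up cs) + (count right cs + count right cs)
      ≡⟨ interchange (count up cs) _ _ _ ⟩
    (count up cs + count right cs) + (count up cs + count right cs) ∎
  -- The partner of the empty prefix has length twice that of `cs`, and it fits into `ss`; the
  -- partner of `ss` itself gives the other bound.
  2c≤ss : length cs + length cs ≤ length ss
  2c≤ss with vs , vs≼ss , e ← symmetric [] =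
    subst (_≤ length ss) (lengths {[]} {vs} e) (Prefix.length-mono vs≼ss)
  ss≤2c : length ss ≤ length cs + length cs
  ss≤2c with vs , _ , e ← symmetric ≼-refl =
    subst (length ss ≤_) (lengths {ss} {vs} e) (ℕ.m≤m+n (length ss) (length vs))
  length-ss : length ss ≡ length cs + length cs
  length-ss = ℕ.≤-antisym ss≤2c 2c≤ss
  -- The partner of the empty prefix has full length, hence is `ss`.
  count-ss : ∀ s → count s ss ≡ count s cs + count s cs
  count-ss s with vs , vs≼ss , e ← symmetric []
    with refl ← ≼-length⇒≡ (trans (lengths {[]} {vs} e) (sym length-ss)) vs≼ss = e s
  reversed : ∀ {us ws} → reverse ss ≡ us ++ ws → ss ≡ reverse ws ++ reverse us
  reversed {us} {ws} eq =
    trans (sym (reverse-involutive ss)) (trans (cong reverse eq) (reverse-++ us ws))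
  -- Here `ss` is `reverse ws ++ reverse us`, so the partner of `reverse ws` has the same counts as
  -- `us`.
  prefixes : ∀ {us} → us ≼ reverse ss → ∃[ vs ] vs ≼ ss × (∀ s → count s us ≡ count s vs)
  prefixes {us} us≼ with ws , eq ← ≼-split us≼
    with vs , vs≼ss , e ← symmetric (subst (reverse ws ≼_) (sym (reversed {us} eq)) (≼-++ (reverse ws) _))
    = vs , vs≼ss , λ s → sym (ℕ.+-cancelˡ-≡ (count s (reverse ws)) _ _ (begin
      count s (reverse ws) + count s vs           ≡⟨ e s ⟩
      count s cs + count s cs                     ≡⟨ count-ss s ⟨
      count s ss                                  ≡⟨ cong (count s) (reversed {us} eq) ⟩
      count s (reverse ws ++ reverse us)          ≡⟨ count-++ s (reverse ws) (reverse us) ⟩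
      count s (reverse ws) + count s (reverse us) ≡⟨ cong (_ +_) (count-reverse s us) ⟩
      count s (reverse ws) + count s us           ∎))
  ss-palindrome : reverse ss ≡ ss
  ss-palindrome = ≼-length⇒≡ (length-reverse ss) (≼-from-counts (reverse ss) prefixes)

-- Both are prefixes of one word, so their letters agree until `us` ends; since `vs` has no further
-- `right`, it goes on with `up`, and one such letter gives `ws`.
≼-convex : ∀ us vs {ss} → us ≼ ss → vs ≼ ss →
  count right vs ≡ count right us → count up vs ≡ suc (suc (count up us)) →
  ∃[ ws ] ws ≼ ss × count right ws ≡ count right us × count up ws ≡ suc (count up us)
≼-convex []           (up ∷ vs)    []         (refl ∷ q) r u = up ∷ [] , refl ∷ [] , refl , refl
≼-convex (up ∷ us)    (up ∷ vs)    (refl ∷ p) (refl ∷ q) r u =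
  let ws , ws≼ , r′ , u′ = ≼-convex us vs p q r (ℕ.suc-injective u)
  in up ∷ ws , refl ∷ ws≼ , r′ , cong suc u′
≼-convex (right ∷ us) (right ∷ vs) (refl ∷ p) (refl ∷ q) r u =
  let ws , ws≼ , r′ , u′ = ≼-convex us vs p q (ℕ.suc-injective r) u
  in right ∷ ws , refl ∷ ws≼ , cong suc r′ , u′

-- The rotation about a tile

-- The additive form is symmetric in `t` and `u` and matches the sums of counts in
-- `IsSymmetricAbout`.
record Antipodal (c t u : Tile) : Set where
  constructor antipodal
  field
    sum-x : proj₁ t ℤ.+ proj₁ u ≡ proj₁ c ℤ.+ proj₁ c
    sum-y : proj₂ t ℤ.+ proj₂ u ≡ proj₂ c ℤ.+ proj₂ c

open Antipodal

Antipodal-sym : ∀ {c t u} → Antipodal c t u → Antipodal c u t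
Antipodal-sym {t = x , y} {x′ , y′} (antipodal p q) =
  antipodal (trans (ℤ.+-comm x′ x) p) (trans (ℤ.+-comm y′ y) q)

antipode : Tile → Tile → Tile
antipode (cx , cy) (x , y) = (cx ℤ.+ cx) ℤ.- x , (cy ℤ.+ cy) ℤ.- y

antipode-Antipodal : ∀ c t → Antipodal c t (antipode c t)
antipode-Antipodal (cx , cy) (x , y) = antipodal (lemma x (cx ℤ.+ cx)) (lemma y (cy ℤ.+ cy))
  where
  lemma : ∀ a b → a ℤ.+ (b ℤ.- a) ≡ b
  lemma = solve-∀

oppositeCorner : Corner → Corner
oppositeCorner sw = ne
oppositeCorner se = nw
oppositeCorner nw = se
oppositeCorner ne = sw

oppositeSide : Side → Side
oppositeSide south = north
oppositeSide north = south
oppositeSide east  = west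
oppositeSide west  = east

-- The rotation in one coordinate: the interval from `a` to `a + 1` is reversed onto the one from
-- `b` to `b + 1`, the near endpoint being `a` and the far one `a + 1`.
rotate-near : ∀ a b c → a ℤ.+ b ≡ c ℤ.+ c → (c ℤ.+ c ℤ.+ 1ℤ) ℤ.- a ≡ b ℤ.+ 1ℤ
rotate-near a b c eq = trans (cong (λ d → d ℤ.+ 1ℤ ℤ.- a) (sym eq)) (lemma a b)
  where
  lemma : ∀ a b → (a ℤ.+ b ℤ.+ 1ℤ) ℤ.- a ≡ b ℤ.+ 1ℤ
  lemma = solve-∀

rotate-far : ∀ a b c → a ℤ.+ b ≡ c ℤ.+ c → (c ℤ.+ c ℤ.+ 1ℤ) ℤ.- (a ℤ.+ 1ℤ) ≡ b
rotate-far a b c eq = trans (cong (λ d → d ℤ.+ 1ℤ ℤ.- (a ℤ.+ 1ℤ)) (sym eq)) (lemma a b)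
  where
  lemma : ∀ a b → (a ℤ.+ b ℤ.+ 1ℤ) ℤ.- (a ℤ.+ 1ℤ) ≡ b
  lemma = solve-∀

rotatePoint-corner : ∀ {c t u} → Antipodal c t u → ∀ κ → rotatePoint c (corner t κ) ≡ corner u (oppositeCorner κ)
rotatePoint-corner {cx , cy} {x , y} {x′ , y′} (antipodal p q) sw =
  cong₂ _,_ (rotate-near x x′ cx p) (rotate-near y y′ cy q)
rotatePoint-corner {cx , cy} {x , y} {x′ , y′} (antipodal p q) se =
  cong₂ _,_ (rotate-far x x′ cx p) (rotate-near y y′ cy q)
rotatePoint-corner {cx , cy} {x , y} {x′ , y′} (antipodal p q) nw =
  cong₂ _,_ (rotate-near x x′ cx p) (rotate-far y y′ cy q)
rotatePoint-corner {cx , cy} {x , y} {x′ , y′} (antipodal p q) ne =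
  cong₂ _,_ (rotate-far x x′ cx p) (rotate-far y y′ cy q)

rotateSegment-side : ∀ {c t u} → Antipodal c t u → ∀ σ → rotateSegment c (side t σ) ≡ side u (oppositeSide σ)
rotateSegment-side {cx , cy} {x , y} {x′ , y′} (antipodal p q) south =
  cong horizontal (cong₂ _,_ (rotate-far x x′ cx p) (rotate-near y y′ cy q))
rotateSegment-side {cx , cy} {x , y} {x′ , y′} (antipodal p q) north =
  cong horizontal (cong₂ _,_ (rotate-far x x′ cx p) (rotate-far y y′ cy q))
rotateSegment-side {cx , cy} {x , y} {x′ , y′} (antipodal p q) west =
  cong vertical (cong₂ _,_ (rotate-near x x′ cx p) (rotate-far y y′ cy q))
rotateSegment-side {cx , cy} {x , y} {x′ , y′} (antipodal p q) east =
  cong vertical (cong₂ _,_ (rotate-far x x′ cx p) (rotate-far y y′ cy q))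

-- Tiles of a snake graph under the rotation

IsTile : SnakeGraph → Tile → Set
IsTile G t = ∃[ i ] tile G i ≡ t

tile⇒position : ∀ G i → ∃[ us ] us ≼ toList (steps G) × tile G i ≡ position us
tile⇒position G = tileFrom⇒offset (0ℤ , 0ℤ) (steps G)

position⇒tile : ∀ G {us} → us ≼ toList (steps G) → IsTile G (position us)
position⇒tile G = offset⇒tileFrom (0ℤ , 0ℤ) (steps G)

tile-convex : ∀ G j k → tile G k ≡ translate up (translate up (tile G j)) →
              IsTile G (translate up (tile G j))
tile-convex G j k eq
  with us , us≼ , us≡ ← tile⇒position G j | vs , vs≼ , vs≡ ← tile⇒position G k
  with position≡ ← trans (sym vs≡) (trans eq (cong (translate up ∘ translate up) us≡))
  with ws , ws≼ , r , u ← ≼-convex us vs us≼ vs≼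
         (ℤ.+-injective (cong proj₁ position≡))
         (trans (ℤ.+-injective (cong proj₂ position≡)) 
           (trans (ℕ.+-comm _ 1) (cong suc (ℕ.+-comm _ 1))))
  with i , i≡ ← position⇒tile G ws≼
  = i , trans i≡ (trans (cong₂ _,_ (cong pos r) (cong pos (trans u (ℕ.+-comm 1 _))))
                        (cong (translate up) (sym us≡)))

horizontal-injective : ∀ {p q} → horizontal p ≡ horizontal q → p ≡ q
horizontal-injective refl = refl

translate-up-injective : ∀ p q → translate up p ≡ translate up q → p ≡ q
translate-up-injective (x , y) (x′ , y′) eq =
  cong₂ _,_ (cong proj₁ eq) (∙-cancelʳ 1ℤ y y′ (cong proj₂ eq))

southNorth⇒tile : ∀ G {t} → IsEdge G (side t south) → IsEdge G (side t north) → IsTile G t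
southNorth⇒tile G (j , south , eq) _                = j , sym (horizontal-injective eq)
southNorth⇒tile G (j , north , _)  (k , north , eq) =
  k , sym (translate-up-injective _ _ (horizontal-injective eq))
-- The remaining case: tile `j` lies directly below `t` and tile `k` directly above it.
southNorth⇒tile G (j , north , eq) (k , south , eq′) with refl ← horizontal-injective eq =
  tile-convex G j k (sym (horizontal-injective eq′))

TilesSymmetricAbout : SnakeGraph → Tile → Set
TilesSymmetricAbout G c = ∀ j → ∃[ k ] Antipodal c (tile G j) (tile G k)

edges⇒tiles : ∀ G {c} → rotateSegment c MapsOntoItself IsEdge G → TilesSymmetricAbout G c
edges⇒tiles G {c} (into , _) j =
  -- The rotation exchanges north and south, so the south edge of the antipode is the image of the
  -- north edge of tile `j`.
  let i , i≡ = southNorth⇒tile G (rotated north) (rotated south)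
  in i , subst (Antipodal c (tile G j)) (sym i≡) ant
  where
  ant : Antipodal c (tile G j) (antipode c (tile G j))
  ant = antipode-Antipodal c (tile G j)
  rotated : ∀ σ → IsEdge G (side (antipode c (tile G j)) (oppositeSide σ))
  rotated σ = into (side (tile G j) σ , (j , σ , refl) , rotateSegment-side ant σ)

oppositeCorner-involutive : ∀ κ → oppositeCorner (oppositeCorner κ) ≡ κ
oppositeCorner-involutive sw = refl
oppositeCorner-involutive se = refl
oppositeCorner-involutive nw = refl
oppositeCorner-involutive ne = refl

oppositeSide-involutive : ∀ σ → oppositeSide (oppositeSide σ) ≡ σ
oppositeSide-involutive south = refl
oppositeSide-involutive east  = refl
oppositeSide-involutive north = refl
oppositeSide-involutive west  = refl

tiles⇒vertices : ∀ G {c} → TilesSymmetricAbout G c → rotatePoint c MapsOntoItself IsVertex G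
tiles⇒vertices G {c} symmetric = into , onto
  where
  into : ∀ {p} → ∃[ q ] IsVertex G q × rotatePoint c q ≡ p → IsVertex G p
  into (_ , (j , κ , refl) , refl) with k , ant ← symmetric j =
    k , oppositeCorner κ , rotatePoint-corner ant κ
  -- The preimage lies on the partner tile `k`, which the rotation sends back to tile `j`.
  onto : ∀ {p} → IsVertex G p → ∃[ q ] IsVertex G q × rotatePoint c q ≡ p
  onto (j , κ , refl) with k , ant ← symmetric j =
    _ , (k , oppositeCorner κ , refl) ,
    trans (rotatePoint-corner (Antipodal-sym ant) (oppositeCorner κ))
          (cong (corner (tile G j)) (oppositeCorner-involutive κ))

tiles⇒edges : ∀ G {c} → TilesSymmetricAbout G c → rotateSegment c MapsOntoItself IsEdge G
tiles⇒edges G {c} symmetric = into , onto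
  where
  into : ∀ {e} → ∃[ d ] IsEdge G d × rotateSegment c d ≡ e → IsEdge G e
  into (_ , (j , σ , refl) , refl) with k , ant ← symmetric j =
    k , oppositeSide σ , rotateSegment-side ant σ
  onto : ∀ {e} → IsEdge G e → ∃[ d ] IsEdge G d × rotateSegment c d ≡ e
  onto (j , σ , refl) with k , ant ← symmetric j =
    _ , (k , oppositeSide σ , refl) ,
    trans (rotateSegment-side (Antipodal-sym ant) (oppositeSide σ))
          (cong (side (tile G j)) (oppositeSide-involutive σ))

symmetricPath⇒tiles : ∀ G cs → IsSymmetricAbout (toList (steps G)) cs →
                      TilesSymmetricAbout G (position cs)
symmetricPath⇒tiles G cs symmetric j
  with us , us≼ , us≡ ← tile⇒position G j
  with vs , vs≼ , e ← symmetric us≼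
  with k , k≡ ← position⇒tile G vs≼
  = k , subst₂ (Antipodal _) (sym us≡) (sym k≡) (antipodal (cong pos (e right)) (cong pos (e up)))

tiles⇒symmetricPath : ∀ G cs → TilesSymmetricAbout G (position cs) →
                      IsSymmetricAbout (toList (steps G)) cs
tiles⇒symmetricPath G cs symmetric us≼
  with j , j≡ ← position⇒tile G us≼
  with k , ant ← symmetric j
  with vs , vs≼ , vs≡ ← tile⇒position G k
  rewrite j≡ | vs≡ = vs , vs≼ , λ where
    up    → ℤ.+-injective (sum-y ant)
    right → ℤ.+-injective (sum-x ant)

-- Rotational symmetry and even palindromes of steps

evenPalindrome⇒rotational : ∀ G → IsEvenPalindrome (toList (steps G)) →
                            HasRotationalSymmetryAtCenterTile G
evenPalindrome⇒rotational G (cs , steps≡)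
  -- The center tile is the one reached after the first half `cs` of the word.
  with c , c≡ ← position⇒tile G (subst (cs ≼_) (sym steps≡) (≼-++ cs (reverse cs)))
  = c , tiles⇒vertices G symmetric , tiles⇒edges G symmetric
  where
  symmetric : TilesSymmetricAbout G (tile G c)
  symmetric = subst (TilesSymmetricAbout G) (sym c≡) (symmetricPath⇒tiles G cs
    (subst (λ ss → IsSymmetricAbout ss cs) (sym steps≡) (evenPalindrome⇒symmetric cs)))

rotational⇒evenPalindrome : ∀ G → HasRotationalSymmetryAtCenterTile G →
                            IsEvenPalindrome (toList (steps G))
rotational⇒evenPalindrome G (c , _ , edges) with cs , _ , c≡ ← tile⇒position G c =
  symmetric⇒evenPalindrome cs
    (tiles⇒symmetricPath G cs (subst (TilesSymmetricAbout G) c≡ (edges⇒tiles G edges)))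

theorem3p7 : (G : SnakeGraph) → IsPalindromicOfEvenLength G ⇔ HasRotationalSymmetryAtCenterTile G
theorem3p7 G = mk⇔
  (evenPalindrome⇒rotational G ∘ palindromic⇒evenPalindrome G)
  (evenPalindrome⇒palindromic G ∘ rotational⇒evenPalindrome G)
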